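{- Let $G$ be a connected (bull, chair)-free graph. Then $\mathsf{lpt}(G) \le 5$.
   Context: All graphs are finite and simple. A chair is the graph obtained by subdividing one edge of the claw $K_{1,3}$ exactly once. A bull is the graph obtained from a four-vertex path by adding a vertex adjacent to exactly the two middle vertices of the path. A graph is (bull, chair)-free if it has no induced subgraph isomorphic to a bull or a chair. A longest path of a connected graph $G$ is a path of maximum length in $G$; a longest path transversal is a set of vertices meeting every longest path; $\mathsf{lpt}(G)$ is the minimum cardinality of a longest path transversal of $G$. -}

module Defs where

open import Data.Nat.Base using (ℕ; zero; suc; _≤_; _<_)
open import Data.Nat.Properties using (_≤?_; ≮⇒≥; allUpTo?; anyUpTo?)
import Data.Nat.Properties as ℕ
open import Data.Nat.Induction using (<-rec)
open import Data.Fin.Base using (Fin)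
open import Data.Fin.Patterns using (0F; 1F; 2F; 3F; 4F)
open import Data.Fin.Properties using (_≟_; all?; injective⇒≤)
open import Data.Fin.Subset using (Subset; _∈_; ∣_∣; ⊤)
open import Data.Fin.Subset.Properties using (_∈?_; anySubset?; ∈⊤)
open import Data.List.Base using (List; []; _∷_)
import Data.List.Membership.Propositional as List
import Data.List.Membership.DecPropositional as DecList
open import Data.Vec.Base using (Vec; []; _∷_; lookup)
open import Data.Vec.Relation.Unary.AllPairs using (allPairs?)
open import Data.Vec.Relation.Unary.Any using (Any; here; any?)
open import Data.Vec.Relation.Unary.Linked using (Linked; linked?)
open import Data.Vec.Relation.Unary.Unique.Propositional using (Unique)
open import Data.Vec.Relation.Unary.Unique.Propositional.Properties using (lookup-injective)
open import Data.Product.Base using (∃; ∃-syntax; _×_; _,_; proj₁; proj₂)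
open import Data.Product.Properties using (≡-dec)
open import Data.Sum.Base using (_⊎_; swap)
open import Function.Base using (_∘_)
open import Function.Bundles using (_⇔_)
open import Function.Definitions using (Injective)
open import Level using (0ℓ)
open import Relation.Binary.Construct.Closure.ReflexiveTransitive using (Star)
open import Relation.Binary.Core using (Rel)
open import Relation.Binary.Definitions using (Decidable; Symmetric; Irreflexive)
open import Relation.Binary.PropositionalEquality using (_≡_; _≢_; refl; sym)
open import Relation.Nullary.Decidable using (Dec; yes; no; map′; ¬?; _×-dec_; _⊎-dec_; _→-dec_)
open import Relation.Nullary.Negation using (¬_)
import Relation.Unary as U

-- Finite simple graphs, up to a labelling of the vertices by Fin order.
-- Classically adj? is no restriction.
record Graph : Set₁ where
  field
    order      : ℕ
    Adj        : Rel (Fin order) 0ℓ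
    adj?       : Decidable Adj
    symmetric  : Symmetric Adj
    loopless   : Irreflexive _≡_ Adj

  Vertex : Set
  Vertex = Fin order

open Graph using (Vertex)

-- Each edge is listed in one orientation only; pairs (u , u) are ignored.
fromEdges : (n : ℕ) → List (Fin n × Fin n) → Graph
fromEdges n es = record
  { order     = n
  ; Adj       = λ u v → u ≢ v × ((u , v) List.∈ es ⊎ (v , u) List.∈ es)
  ; adj?      = λ u v → ¬? (u ≟ v) ×-dec (((u , v) ∈ₑ? es) ⊎-dec ((v , u) ∈ₑ? es))
  ; symmetric = λ (u≢v , uv∈es) → (u≢v ∘ sym) , swap uv∈es
  ; loopless  = λ u≡v (u≢v , _) → u≢v u≡v
  }
  where open DecList (≡-dec _≟_ _≟_) renaming (_∈?_ to _∈ₑ?_)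

-- The claw with centre 0 and leaves 1, 2, 3, its edge 03 subdivided by 4.
chair : Graph
chair = fromEdges 5 ((0F , 1F) ∷ (0F , 2F) ∷ (0F , 4F) ∷ (4F , 3F) ∷ [])

-- The path 0123 together with 4, adjacent to the middle vertices 1 and 2.
bull : Graph
bull = fromEdges 5 ((0F , 1F) ∷ (1F , 2F) ∷ (2F , 3F) ∷ (4F , 1F) ∷ (4F , 2F) ∷ [])

-- H is isomorphic to the subgraph of G induced by the image of f.
_InducedIn_ : Graph → Graph → Set
H InducedIn G = ∃[ f ] Injective _≡_ _≡_ f ×
  (∀ (u v : Vertex H) → Graph.Adj H u v ⇔ Graph.Adj G (f u) (f v))

_-Free : Graph → Graph → Set
(H -Free) G = ¬ (H InducedIn G)

Bull-Chair-Free : Graph → Set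
Bull-Chair-Free G = (bull -Free) G × (chair -Free) G

module _ (G : Graph) where
  open Graph G using (order; Adj)

  private
    V : Set
    V = Vertex G

  -- The graph without vertices is not excluded; it has no paths, hence no
  -- longest path, and its transversal number is 0.
  Connected : Set
  Connected = ∀ (u v : V) → Star Adj u v

  -- A path of length k (number of edges), given by its k + 1 successive
  -- vertices. Its reversal represents the same path.
  IsPath : ∀ {k} → Vec V (suc k) → Set
  IsPath p = Linked Adj p × Unique p

  IsLongestPath : ∀ {k} → Vec V (suc k) → Set
  IsLongestPath {k} p = IsPath p × (∀ {l} (q : Vec V (suc l)) → IsPath q → l ≤ k)

  Meets : ∀ {k} → Subset order → Vec V k → Set
  Meets S p = Any (_∈ S) p

  IsTransversal : Subset order → Set
  IsTransversal S = ∀ {k} (p : Vec V (suc k)) → IsLongestPath p → Meets S p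

  TransversalOfSize : ℕ → Set
  TransversalOfSize k = ∃[ S ] IsTransversal S × ∣ S ∣ ≡ k

  IsLpt : ℕ → Set
  IsLpt k = TransversalOfSize k × (∀ {j} → TransversalOfSize j → k ≤ j)

private
  allVec? : ∀ {n k} {P : U.Pred (Vec (Fin n) k) 0ℓ} → U.Decidable P → Dec (∀ v → P v)
  allVec? {k = zero}  P? = map′ (λ { p [] → p }) (λ f → f []) (P? [])
  allVec? {k = suc k} P? =
    map′ (λ { f (x ∷ v) → f x v }) (λ f x v → f (x ∷ v))
         (all? λ x → allVec? λ v → P? (x ∷ v))

  least : {P : U.Pred ℕ 0ℓ} → U.Decidable P → ∃ P → ∃[ k ] P k × (∀ {j} → P j → k ≤ j)
  least {P} P? (m , Pm) = <-rec (λ n → P n → Result) step m Pm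
    where
    Result : Set
    Result = ∃[ k ] P k × (∀ {j} → P j → k ≤ j)

    step : ∀ n → (∀ {i} → i < n → P i → Result) → P n → Result
    step n rec Pn with anyUpTo? P? n
    ... | yes (i , i<n , Pi) = rec i<n Pi
    ... | no  none           = n , Pn , λ {j} Pj → ≮⇒≥ λ j<n → none (j , j<n , Pj)

module _ (G : Graph) where
  open Graph G using (order; adj?)

  path? : ∀ {k} → U.Decidable (IsPath G {k})
  path? p = linked? adj? p ×-dec allPairs? (λ u v → ¬? (u ≟ v)) p

  path-length< : ∀ {k} (p : Vec (Vertex G) (suc k)) → IsPath G p → k < order
  path-length< p (_ , unique) = injective⇒≤ {f = lookup p} (λ {i} {j} → lookup-injective unique i j)

  longestPath? : ∀ {k} → U.Decidable (IsLongestPath G {k})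
  longestPath? {k} p = path? p ×-dec
    map′ (λ f {l} q q-path → f {l} (path-length< q q-path) q q-path) (λ f {l} _ → f {l})
         (allUpTo? (λ l → allVec? λ q → path? q →-dec (l ≤? k)) order)

  transversal? : U.Decidable (IsTransversal G)
  transversal? S =
    map′ (λ f {k} p long → f {k} (path-length< p (proj₁ long)) p long) (λ f {k} _ → f {k})
         (allUpTo? (λ k → allVec? λ p → longestPath? p →-dec any? (_∈? S) p) order)

  ⊤-transversal : IsTransversal G ⊤
  ⊤-transversal (_ ∷ _) _ = here ∈⊤

  lpt-exists : ∃ (IsLpt G)
  lpt-exists = least
    (λ k → anySubset? λ S → transversal? S ×-dec (∣ S ∣ ℕ.≟ k))
    (∣ ⊤ {order} ∣ , ⊤ , ⊤-transversal , refl)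

  lpt : ℕ
  lpt = proj₁ lpt-exists

  lpt-isLpt : IsLpt G lpt
  lpt-isLpt = proj₂ lpt-exists

{-# OPTIONS --safe #-}
-- A dominating set D meets every longest path, since a path avoiding D can be
-- prolonged at its first vertex; and if G has a Hamiltonian path, then every
-- vertex lies on all longest paths.
--
-- If G has a claw, then every vertex is within distance two of it. Among the
-- vertices adjacent to the claw, choose v₁ and v₂ such that their
-- neighbourhoods together contain as many vertices far from the claw as
-- possible. If they missed one, a neighbour v₃ of it would give three
-- independent neighbours of the centre with private far neighbours, hence a
-- chair. So v₁, v₂, the centre and two leaves dominate G.
--
-- If G is claw-free, a longest induced path q₀ … qₘ dominates G, which settles
-- m ≤ 4. If m ≥ 5, then every vertex behaves like some qⱼ towards the path, or
-- closes it to a cycle (being adjacent to q₀ and qₘ only). These m + 2 classes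
-- are cliques and consecutive ones are completely joined, so listing them one
-- after the other gives a Hamiltonian path.
module Submission where

open import Defs
open import Data.Empty using (⊥; ⊥-elim)
open import Data.Fin.Base using (Fin; toℕ)
open import Data.Fin.Patterns using (0F; 1F; 2F; 3F; 4F)
open import Data.Fin.Properties using (_≟_; all?; any?; injective⇒≤; toℕ<n; toℕ-injective)
open import Data.Fin.Subset using (Subset; _∈_; _⊂_; _⊃_; ∣_∣; _∪_; ⁅_⁆; inside; outside) renaming (⊥ to ∅)
open import Data.Fin.Subset.Induction using (Acc; acc; ⊃-wellFounded)
open import Data.Fin.Subset.Properties using (_∈?_; ∣⊥∣≡0; ∣⁅x⁆∣≡1; x∈⁅x⁆; x∈p∪q⁺)
open import Data.List.Base as List using (List; []; _∷_; _++_; allFin; filter; head; length)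
import Data.List.Membership.DecPropositional as DecList
open import Data.List.Membership.Propositional using (find) renaming (_∈_ to _∈ₗ_)
open import Data.List.Membership.Propositional.Properties using (∈-++⁺ˡ; ∈-++⁺ʳ; ∈-allFin; ∈-filter⁺)
import Data.List.Membership.Setoid.Properties as ∈ₛ
import Data.List.Properties as List
open import Data.List.Relation.Unary.All as All using (All; []; _∷_)
import Data.List.Relation.Unary.All.Properties as All
open import Data.List.Relation.Unary.AllPairs using (AllPairs; []; _∷_)
import Data.List.Relation.Unary.AllPairs.Properties as AllPairs
open import Data.List.Relation.Unary.Any using (Any; here; there)
import Data.List.Relation.Unary.Any.Properties as Any
open import Data.List.Relation.Unary.Linked using (Linked; []; [-]; _∷_)
open import Data.List.Relation.Unary.Unique.Propositional using (Unique)
import Data.List.Relation.Unary.Unique.Propositional.Properties as Unique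
import Data.Maybe.Relation.Unary.All as Maybe
open import Data.Nat.Base using (ℕ; zero; suc; _+_; _∸_; _≤_; _<_; z≤n; s≤s; s≤s⁻¹)
open import Data.Nat.Properties using
  (≤-refl; ≤-reflexive; ≤-trans; +-suc; +-monoʳ-≤; m≤n⇒m≤1+n; m≤m+n; m≤n+m; n≤1+n; n<1+n; n≮n; 1+n≰n; anyUpTo?)
import Data.Nat.Properties as ℕ
open import Data.Product.Base using (∃; _×_; _,_; proj₁; proj₂)
open import Data.Product.Properties using (≡-dec)
open import Data.Sum.Base using (_⊎_; inj₁; inj₂; [_,_]′)
open import Data.Unit.Base using (tt)
open import Data.Vec.Base as Vec using (Vec; []; _∷_; fromList; lookup)
open import Data.Vec.Properties using (lookup∘tabulate; []=⇒lookup; lookup⇒[]=)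
import Data.Vec.Relation.Unary.All as VecAll
import Data.Vec.Relation.Unary.All.Properties as VecAll
import Data.Vec.Relation.Unary.AllPairs as VecAllPairs
import Data.Vec.Relation.Unary.Any as VecAny
import Data.Vec.Relation.Unary.Linked as VecLinked
open import Data.Vec.Relation.Unary.Unique.Propositional.Properties using (lookup-injective)
open import Function.Base using (_∘_)
open import Function.Bundles using (mk⇔)
open import Level using (0ℓ)
open import Relation.Binary.Construct.Closure.ReflexiveTransitive using (Star; ε; _◅_)
open import Relation.Binary.Core using (Rel)
open import Relation.Binary.Definitions using (tri<; tri≈; tri>)
open import Relation.Binary.PropositionalEquality using (_≡_; _≢_; refl; sym; trans; cong; setoid; subst)
open import Relation.Nullary.Decidable using
  (Dec; yes; no; True; does; dec-true; decidable-stable; from-yes; toWitness; ¬?; _×-dec_; _⊎-dec_; _→-dec_)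
open import Relation.Nullary.Negation using (¬_; contradiction)

-- Cardinalities of subsets; lists and vectors.

∣p∪q∣≤∣p∣+∣q∣ : ∀ {n} (p q : Subset n) → ∣ p ∪ q ∣ ≤ ∣ p ∣ + ∣ q ∣
∣p∪q∣≤∣p∣+∣q∣ []            []            = z≤n
∣p∪q∣≤∣p∣+∣q∣ (outside ∷ p) (outside ∷ q) = ∣p∪q∣≤∣p∣+∣q∣ p q
∣p∪q∣≤∣p∣+∣q∣ (outside ∷ p) (inside ∷ q)  =
  subst (suc ∣ p ∪ q ∣ ≤_) (sym (+-suc ∣ p ∣ ∣ q ∣)) (s≤s (∣p∪q∣≤∣p∣+∣q∣ p q))
∣p∪q∣≤∣p∣+∣q∣ (inside ∷ p)  (outside ∷ q) = s≤s (∣p∪q∣≤∣p∣+∣q∣ p q)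
∣p∪q∣≤∣p∣+∣q∣ (inside ∷ p)  (inside ∷ q)  =
  s≤s (≤-trans (∣p∪q∣≤∣p∣+∣q∣ p q) (+-monoʳ-≤ ∣ p ∣ (m≤n⇒m≤1+n ≤-refl)))

elements : ∀ {n} → List (Fin n) → Subset n
elements = List.foldr (λ x S → ⁅ x ⁆ ∪ S) ∅

∣elements∣≤length : ∀ {n} (xs : List (Fin n)) → ∣ elements xs ∣ ≤ length xs
∣elements∣≤length {n} []       = ≤-reflexive (∣⊥∣≡0 n)
∣elements∣≤length     (x ∷ xs) = ≤-trans (∣p∪q∣≤∣p∣+∣q∣ ⁅ x ⁆ (elements xs))
  (subst (λ k → k + ∣ elements xs ∣ ≤ suc (length xs)) (sym (∣⁅x⁆∣≡1 x)) (s≤s (∣elements∣≤length xs)))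

∈-elements : ∀ {n x} {xs : List (Fin n)} → x ∈ₗ xs → x ∈ elements xs
∈-elements (here refl) = x∈p∪q⁺ (inj₁ (x∈⁅x⁆ _))
∈-elements (there x∈)  = x∈p∪q⁺ (inj₂ (∈-elements x∈))

¬Any⇒All¬ : ∀ {A : Set} {P : A → Set} {n} (xs : Vec A n) → ¬ VecAny.Any P xs → VecAll.All (¬_ ∘ P) xs
¬Any⇒All¬ []       _ = VecAll.[]
¬Any⇒All¬ (x ∷ xs) ¬p = (¬p ∘ VecAny.here) VecAll.∷ ¬Any⇒All¬ xs (¬p ∘ VecAny.there)

fromList-linked : ∀ {A : Set} {R : Rel A 0ℓ} {xs} → Linked R xs → VecLinked.Linked R (fromList xs)
fromList-linked []          = VecLinked.[]
fromList-linked [-]         = VecLinked.[-]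
fromList-linked (r ∷ rs)    = r VecLinked.∷ fromList-linked rs

fromList-allPairs : ∀ {A : Set} {R : Rel A 0ℓ} {xs} → AllPairs R xs → VecAllPairs.AllPairs R (fromList xs)
fromList-allPairs []       = VecAllPairs.[]
fromList-allPairs (r ∷ rs) = VecAll.fromList⁺ r VecAllPairs.∷ fromList-allPairs rs

covering⇒≤length : ∀ {n} {xs : List (Fin n)} → (∀ x → x ∈ₗ xs) → n ≤ length xs
covering⇒≤length mem = injective⇒≤ (λ {x} {y} → ∈ₛ.index-injective (setoid _) (mem x) (mem y))

-- Relating every element of `xs` to the head of `ys` avoids naming the last element of `xs`; for
-- empty `ys` this condition is vacuous.
linked-++ : ∀ {A : Set} {R : Rel A 0ℓ} {xs ys : List A} → AllPairs R xs → Linked R ys →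
            All (λ x → Maybe.All (R x) (head ys)) xs → Linked R (xs ++ ys)
linked-++ {xs = []}         []             ys-linked _ = ys-linked
linked-++ {xs = x ∷ []} {[]}     (_ ∷ _)   ys-linked _ = [-]
linked-++ {xs = x ∷ []} {y ∷ ys} (_ ∷ _)   ys-linked (Maybe.just r ∷ _) = r ∷ ys-linked
linked-++ {xs = x ∷ x′ ∷ xs} ((r ∷ _) ∷ rs) ys-linked (_ ∷ js) = r ∷ linked-++ rs ys-linked js

-- Transversals from dominating sets and from Hamiltonian paths.

module Transversals (G : Graph) where
  open Graph G

  Dominating : List Vertex → Set
  Dominating D = ∀ u → Any (λ d → u ≡ d ⊎ Adj u d) D

  lpt≤∣transversal∣ : ∀ S → IsTransversal G S → lpt G ≤ ∣ S ∣
  lpt≤∣transversal∣ S S-trans = proj₂ (lpt-isLpt G) (S , S-trans , refl)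

  dominating⇒transversal : ∀ {D} → Dominating D → IsTransversal G (elements D)
  dominating⇒transversal {D} dom p@(x ∷ _) ((linked , unique) , longest) with VecAny.any? (_∈? elements D) p
  ... | yes meets = meets
  ... | no  avoids with find (dom x)
  ...   | d , d∈D , inj₁ refl = contradiction (VecAny.here (∈-elements d∈D)) avoids
  ...   | d , d∈D , inj₂ x~d  = contradiction
    (longest (d ∷ p) (symmetric x~d VecLinked.∷ linked , d∉p VecAllPairs.∷ unique)) 1+n≰n
    where
    d∉p : VecAll.All (d ≢_) p
    d∉p = VecAll.map (λ { y∉D refl → y∉D (∈-elements d∈D) }) (¬Any⇒All¬ p avoids)

  dominating⇒lpt≤ : ∀ {D} → Dominating D → lpt G ≤ length D
  dominating⇒lpt≤ {D} dom =
    ≤-trans (lpt≤∣transversal∣ (elements D) (dominating⇒transversal dom)) (∣elements∣≤length D)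

  hamiltonian⇒lpt≤1 : ∀ {xs} → Linked Adj xs → Unique xs → (∀ x → x ∈ₗ xs) → Vertex → lpt G ≤ 1
  hamiltonian⇒lpt≤1 {[]}     _      _      covers v = contradiction (covers v) λ ()
  hamiltonian⇒lpt≤1 {x ∷ xs} linked unique covers v =
    subst (lpt G ≤_) (∣⁅x⁆∣≡1 v) (lpt≤∣transversal∣ ⁅ v ⁆ meets-v)
    where
    meets-v : IsTransversal G ⁅ v ⁆
    meets-v {k} p ((_ , p-unique) , longest) with VecAny.any? (_∈? ⁅ v ⁆) p
    ... | yes meets = meets
    ... | no avoids = contradiction
      -- The `k + 2` distinct vertices of `v ∷ p` give `k + 2 ≤ order`, while the Hamiltonian path
      -- has at most `k + 1` vertices because `p` is longest.
      (≤-trans (injective⇒≤ (λ {i} {j} → lookup-injective v∷p-unique i j))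
        (≤-trans (covering⇒≤length covers) (s≤s (longest (fromList (x ∷ xs))
          (fromList-linked linked , fromList-allPairs unique)))))
      1+n≰n
      where
      v∷p-unique : VecAllPairs.AllPairs _≢_ (v ∷ p)
      v∷p-unique = VecAll.map (λ { y∉ refl → y∉ (x∈⁅x⁆ _) }) (¬Any⇒All¬ p avoids) VecAllPairs.∷ p-unique

  -- The layers, concatenated by increasing level, form a Hamiltonian path. An empty layer would
  -- break the chain, except at `top`, where nothing follows.
  module Layered
    (level : Vertex → ℕ) {top : ℕ}
    (level≤top : ∀ u → level u ≤ top)
    (clique : ∀ {u v} → u ≢ v → level u ≡ level v → Adj u v)
    (consecutive : ∀ {u v} → suc (level u) ≡ level v → Adj u v)
    (nonempty : ∀ {c} → c < top → ∃ λ u → level u ≡ c)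
    where

    layer : ℕ → List Vertex
    layer c = filter (λ u → level u ℕ.≟ c) (allFin order)

    layers : ℕ → ℕ → List Vertex
    layers c zero    = []
    layers c (suc k) = layer c ++ layers (suc c) k

    ∈-layer : ∀ {u c} → level u ≡ c → u ∈ₗ layer c
    ∈-layer {u} = ∈-filter⁺ (λ u → level u ℕ.≟ _) (∈-allFin u)

    layer-level : ∀ c → All (λ u → level u ≡ c) (layer c)
    layer-level c = All.all-filter (λ u → level u ℕ.≟ c) (allFin order)

    layer-unique : ∀ c → Unique (layer c)
    layer-unique c = AllPairs.filter⁺ (λ u → level u ℕ.≟ c) (Unique.allFin⁺ order)

    layer-clique : ∀ c → AllPairs Adj (layer c)
    layer-clique c = go (layer-unique c) (layer-level c)
      where
      go : ∀ {xs} → Unique xs → All (λ u → level u ≡ c) xs → AllPairs Adj xs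
      go []        []        = []
      go (n ∷ ns) (l ∷ ls) =
        All.zipWith (λ (u≢v , l′) → clique u≢v (trans l (sym l′))) (n , ls) ∷ go ns ls

    layers-level : ∀ c k → All (λ u → c ≤ level u) (layers c k)
    layers-level c zero    = []
    layers-level c (suc k) = All.++⁺ (All.map (≤-reflexive ∘ sym) (layer-level c))
      (All.map ℕ.<⇒≤ (layers-level (suc c) k))

    layers-unique : ∀ c k → Unique (layers c k)
    layers-unique c zero    = []
    layers-unique c (suc k) = AllPairs.++⁺ (layer-unique c) (layers-unique (suc c) k)
      (All.map (λ { refl → All.map (λ { c<c refl → n≮n _ c<c }) (layers-level (suc c) k) }) (layer-level c))

    layers-complete : ∀ {u} c k → c ≤ level u → level u < c + k → u ∈ₗ layers c k
    layers-complete {u} c zero    c≤ <c+k = contradiction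
      (≤-trans <c+k (≤-trans (≤-reflexive (ℕ.+-identityʳ c)) c≤)) 1+n≰n
    layers-complete {u} c (suc k) c≤ <c+k with ℕ.m≤n⇒m<n∨m≡n c≤
    ... | inj₁ c< = ∈-++⁺ʳ (layer c) (layers-complete (suc c) k c< (subst (level u <_) (+-suc c k) <c+k))
    ... | inj₂ c≡ = ∈-++⁺ˡ (∈-layer (sym c≡))

    -- The head could come from a higher level only if layer `c` were empty and another layer
    -- followed, but then `c < top`.
    layers-head : ∀ c k → c + k ≡ suc top → Maybe.All (λ u → level u ≡ c) (head (layers c k))
    layers-head c zero    _ = Maybe.nothing
    layers-head c (suc k) e with layer c | layer-level c | (λ {u} → ∈-layer {u} {c})
    ... | _ ∷ _ | l ∷ _ | _   = Maybe.just l
    ... | []    | []    | mem with k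
    ...   | zero  = Maybe.nothing
    ...   | suc k = contradiction (mem (proj₂ (nonempty c<top))) λ ()
      where
      c<top : c < top
      c<top = subst (suc c ≤_) (ℕ.suc-injective (trans (cong suc (sym (+-suc c k)))
        (trans (sym (+-suc c (suc k))) e))) (s≤s (ℕ.m≤m+n c k))

    layers-linked : ∀ c k → c + k ≡ suc top → Linked Adj (layers c k)
    layers-linked c zero    _ = []
    layers-linked c (suc k) e = linked-++ (layer-clique c) (layers-linked (suc c) k e′)
      (All.map to-next (layer-level c))
      where
      e′ = trans (sym (+-suc c k)) e

      to-next : ∀ {u} → level u ≡ c → Maybe.All (Adj u) (head (layers (suc c) k))
      to-next refl = Maybe.map (consecutive ∘ sym) (layers-head (suc c) k e′)

    lpt≤1 : Vertex → lpt G ≤ 1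
    lpt≤1 = hamiltonian⇒lpt≤1 (layers-linked 0 (suc top) refl) (layers-unique 0 (suc top))
      (λ u → layers-complete 0 (suc top) z≤n (s≤s (level≤top u)))

-- Recognising induced bulls and chairs.

-- For a concrete graph `H` the decision evaluates, so each entry of a table over `pairs` reduces to
-- an adjacency or a non-adjacency in `G`.
Agree : {A : Set} → Dec A → Set → Set
Agree (yes _) B = B
Agree (no _)  B = ¬ B

pairs : List (Fin 5 × Fin 5)
pairs = (0F , 1F) ∷ (0F , 2F) ∷ (0F , 3F) ∷ (0F , 4F) ∷ (1F , 2F)
      ∷ (1F , 3F) ∷ (1F , 4F) ∷ (2F , 3F) ∷ (2F , 4F) ∷ (3F , 4F) ∷ []

pairs-complete : ∀ u v → u ≡ v ⊎ ((u , v) ∈ₗ pairs ⊎ (v , u) ∈ₗ pairs)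
pairs-complete = from-yes (all? λ u → all? λ v → (u ≟ v) ⊎-dec (((u , v) ∈ₗ? pairs) ⊎-dec ((v , u) ∈ₗ? pairs)))
  where open DecList (≡-dec _≟_ _≟_) renaming (_∈?_ to _∈ₗ?_)

Twins : (H : Graph) → Graph.Vertex H → Graph.Vertex H → Set
Twins H u v = ∀ w → (Adj u w → Adj v w) × (Adj v w → Adj u w)
  where open Graph H

twins? : ∀ H u v → Dec (Twins H u v)
twins? H u v = all? λ w → (adj? u w →-dec adj? v w) ×-dec (adj? v w →-dec adj? u w)
  where open Graph H

bull-twins : ∀ u v → Twins bull u v → u ≡ v
bull-twins = from-yes (all? λ u → all? λ v → twins? bull u v →-dec (u ≟ v))

chair-twins : ∀ u v → Twins chair u v → u ≡ v ⊎ (u ≡ 1F × v ≡ 2F ⊎ u ≡ 2F × v ≡ 1F)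
chair-twins = from-yes (all? λ u → all? λ v → twins? chair u v →-dec
  ((u ≟ v) ⊎-dec (((u ≟ 1F) ×-dec (v ≟ 2F)) ⊎-dec ((u ≟ 2F) ×-dec (v ≟ 1F)))))

module _ (G : Graph) where
  open Graph G

  module Embedding (es : List (Fin 5 × Fin 5)) (f : Fin 5 → Vertex) where
    private
      H = fromEdges 5 es
      module H = Graph H

    agree⇒⇔ : All (λ (u , v) → Agree (H.adj? u v) (Adj (f u) (f v))) pairs →
              ∀ u v → (H.Adj u v → Adj (f u) (f v)) × (Adj (f u) (f v) → H.Adj u v)
    agree⇒⇔ table u v = by (pairs-complete u v)
      where
      entry : ∀ {u v} → Agree (H.adj? u v) (Adj (f u) (f v)) →
              (H.Adj u v → Adj (f u) (f v)) × (Adj (f u) (f v) → H.Adj u v)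
      entry {u} {v} r with H.adj? u v
      ... | yes e = (λ _ → r) , (λ _ → e)
      ... | no ¬e = (λ e → contradiction e ¬e) , (λ a → contradiction a r)
      by : u ≡ v ⊎ ((u , v) ∈ₗ pairs ⊎ (v , u) ∈ₗ pairs) →
             (H.Adj u v → Adj (f u) (f v)) × (Adj (f u) (f v) → H.Adj u v)
      by (inj₁ refl)     = (λ e → contradiction e (H.loopless refl)) , (λ a → contradiction a (loopless refl))
      by (inj₂ (inj₁ m)) = entry (All.lookup table m)
      by (inj₂ (inj₂ m)) = let to , from = entry (All.lookup table m)
        in symmetric ∘ to ∘ H.symmetric , H.symmetric ∘ from ∘ symmetric

    -- Vertices of H with different neighbourhoods have different images, so
    -- injectivity only has to be required for twins of H.
    inducedIn : All (λ (u , v) → Agree (H.adj? u v) (Adj (f u) (f v))) pairs →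
                (∀ u v → Twins H u v → f u ≡ f v → u ≡ v) →
                H InducedIn G
    inducedIn table twins = f , (λ {u} {v} fu≡fv → twins u v (λ w → transfer fu≡fv , transfer (sym fu≡fv)) fu≡fv)
      , λ u v → mk⇔ (proj₁ (iff u v)) (proj₂ (iff u v))
      where
      iff = agree⇒⇔ table
      transfer : ∀ {u v w} → f u ≡ f v → H.Adj u w → H.Adj v w
      transfer {u} {v} {w} fu≡fv e = proj₂ (iff v w) (subst (λ x → Adj x (f w)) fu≡fv (proj₁ (iff u w) e))

  -- The path w x y z with the apex t.
  no-bull : (bull -Free) G → ∀ {w x y z t} →
            Adj w x → Adj x y → Adj y z → Adj t x → Adj t y →
            ¬ Adj w y → ¬ Adj w z → ¬ Adj w t → ¬ Adj x z → ¬ Adj z t → ⊥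
  no-bull free {w} {x} {y} {z} {t} wx xy yz tx ty w≁y w≁z w≁t x≁z z≁t =
    free (Embedding.inducedIn _ (lookup (w ∷ x ∷ y ∷ z ∷ t ∷ []))
      (wx ∷ w≁y ∷ w≁z ∷ w≁t ∷ xy ∷ x≁z ∷ symmetric tx ∷ yz ∷ symmetric ty ∷ z≁t ∷ [])
      (λ u v tw _ → bull-twins u v tw))

  -- The centre x with the leaves y and z and the path x s t.
  no-chair : (chair -Free) G → ∀ {x y z s t} →
             Adj x y → Adj x z → Adj x s → Adj s t → y ≢ z →
             ¬ Adj y z → ¬ Adj y s → ¬ Adj z s → ¬ Adj y t → ¬ Adj z t → ¬ Adj x t → ⊥
  no-chair free {x} {y} {z} {s} {t} xy xz xs st y≢z y≁z y≁s z≁s y≁t z≁t x≁t =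
    -- In `chair`, vertex 4 subdivides the edge to the leaf 3, hence `t` comes before `s`.
    free (Embedding.inducedIn _ (lookup (x ∷ y ∷ z ∷ t ∷ s ∷ []))
      (xy ∷ xz ∷ x≁t ∷ xs ∷ y≁z ∷ y≁t ∷ y≁s ∷ z≁t ∷ z≁s ∷ symmetric st ∷ [])
      (λ u v tw e → [ (λ u≡v → u≡v)
        , [ (λ { (refl , refl) → contradiction e y≢z })
          , (λ { (refl , refl) → contradiction (sym e) y≢z }) ]′ ]′ (chair-twins u v tw)))

-- Graphs with a claw.

record Claw (G : Graph) : Set where
  open Graph G
  field
    centre  : Vertex
    leaf    : Fin 3 → Vertex
    spoke   : ∀ i → Adj centre (leaf i)
    leaf≢   : ∀ {i j} → i ≢ j → leaf i ≢ leaf j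
    leaf≁   : ∀ {i j} → ¬ Adj (leaf i) (leaf j)

∈-tabulate⁺ : ∀ {n} {P : Fin n → Set} (P? : ∀ x → Dec (P x)) {x} → P x → x ∈ Vec.tabulate (does ∘ P?)
∈-tabulate⁺ P? {x} Px = lookup⇒[]= x _ (trans (lookup∘tabulate _ x) (dec-true (P? x) Px))

∈-tabulate⁻ : ∀ {n} {P : Fin n → Set} (P? : ∀ x → Dec (P x)) {x} → x ∈ Vec.tabulate (does ∘ P?) → P x
∈-tabulate⁻ P? {x} x∈ with P? x | trans (sym (lookup∘tabulate (does ∘ P?) x)) ([]=⇒lookup x∈)
... | yes Px | _ = Px

module ClawCase (G : Graph) (connected : Connected G) (free : Bull-Chair-Free G) (claw : Claw G) where
  open Graph G
  open Transversals G
  open Claw claw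

  bull-absurd = no-bull G (proj₁ free)
  chair-absurd = no-chair G (proj₂ free)

  Near : Vertex → Set
  Near u = Adj centre u ⊎ ∃ λ i → Adj (leaf i) u

  near? : ∀ u → Dec (Near u)
  near? u = adj? centre u ⊎-dec any? λ i → adj? (leaf i) u

  Far : Vertex → Set
  Far u = ¬ Near u

  -- Adjacency to at least two of the three leaves. In this form it is refuted by two missed leaves,
  -- which is what a chair needs.
  TwoOfThree : Vertex → Set
  TwoOfThree v = ∀ {i j} → i ≢ j → Adj v (leaf i) ⊎ Adj v (leaf j)

  ≁-sym : ∀ {u v} → ¬ Adj u v → ¬ Adj v u
  ≁-sym u≁v vu = u≁v (symmetric vu)

  -- Two missed leaves would form a chair with the centre and the path from it through the leaf `k`
  -- to `v`.
  two-of-three′ : ∀ {v} → Near v → ¬ Adj centre v → TwoOfThree v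
  two-of-three′ (inj₁ av)        a≁v = contradiction av a≁v
  two-of-three′ {v} (inj₂ (k , kv)) a≁v {i} {j} i≢j with adj? v (leaf i) | adj? v (leaf j)
  ... | yes vi | _      = inj₁ vi
  ... | _      | yes vj = inj₂ vj
  ... | no v≁i | no v≁j = ⊥-elim
    (chair-absurd (spoke i) (spoke j) (spoke k) kv (leaf≢ i≢j) leaf≁ leaf≁ leaf≁ (≁-sym v≁i) (≁-sym v≁j) a≁v)

  -- The new case is `v` adjacent to the centre: two missed leaves would form a chair with the path
  -- `centre`, `v`, `w`.
  two-of-three : ∀ {v w} → Near v → Far w → Adj v w → TwoOfThree v
  two-of-three {v} near far vw {i} {j} i≢j with adj? centre v | adj? v (leaf i) | adj? v (leaf j)
  ... | no a≁v | _      | _      = two-of-three′ near a≁v i≢j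
  ... | _      | yes vi | _      = inj₁ vi
  ... | _      | _      | yes vj = inj₂ vj
  ... | yes av | no v≁i | no v≁j = ⊥-elim
    (chair-absurd (spoke i) (spoke j) av vw (leaf≢ i≢j) leaf≁ (≁-sym v≁i) (≁-sym v≁j)
      (λ e → far (inj₂ (i , e))) (λ e → far (inj₂ (j , e))) (λ e → far (inj₁ e)))

  two-leaves : ∀ {v} → TwoOfThree v → ∃ λ i → ∃ λ j → i ≢ j × Adj v (leaf i) × Adj v (leaf j)
  two-leaves s with s {0F} {1F} (λ ())
  ... | inj₁ e₀ = [ (λ e₁ → 0F , 1F , (λ ()) , e₀ , e₁) , (λ e₂ → 0F , 2F , (λ ()) , e₀ , e₂) ]′ (s {1F} {2F} (λ ()))
  ... | inj₂ e₁ = [ (λ e₀ → 0F , 1F , (λ ()) , e₀ , e₁) , (λ e₂ → 1F , 2F , (λ ()) , e₁ , e₂) ]′ (s {0F} {2F} (λ ()))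

  common-leaf : ∀ {v v′} → TwoOfThree v → TwoOfThree v′ → ∃ λ i → Adj v (leaf i) × Adj v′ (leaf i)
  common-leaf s s′ with two-leaves s
  ... | i , j , i≢j , vi , vj = [ (λ v′i → i , vi , v′i) , (λ v′j → j , vj , v′j) ]′ (s′ i≢j)

  -- Two leaves adjacent to `v` and the path `v`, `w`, `w′` would form a chair centred at `v`. This
  -- bounds the distance from the claw, and also separates private far neighbours.
  no-third-step : ∀ {v w w′} → Near v → Adj v w → Far w → Far w′ → ¬ Adj v w′ → ¬ Adj w w′
  no-third-step near vw far far′ v≁w′ ww′ with two-leaves (two-of-three near far vw)
  ... | i , j , i≢j , vi , vj =
    chair-absurd vi vj vw ww′ (leaf≢ i≢j) leaf≁ (λ e → far (inj₂ (i , e))) (λ e → far (inj₂ (j , e)))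
      (λ e → far′ (inj₂ (i , e))) (λ e → far′ (inj₂ (j , e))) v≁w′

  Reached : Vertex → Set
  Reached u = Near u ⊎ ∃ λ v → Near v × Adj v u

  reached-step : ∀ {u u′} → Reached u → Adj u u′ → Reached u′
  reached-step {u} (inj₁ near) uu′ = inj₂ (u , near , uu′)
  reached-step {u} {u′} (inj₂ (v , near , vu)) uu′ with near? u | near? u′ | adj? v u′
  ... | yes near-u | _       | _        = inj₂ (u , near-u , uu′)
  ... | _       | yes near′  | _        = inj₁ near′
  ... | _       | _          | yes vu′  = inj₂ (v , near , vu′)
  ... | no far  | no far′    | no v≁u′  = contradiction uu′ (no-third-step near vu far far′ v≁u′)

  near-centre : Near centre
  near-centre = inj₂ (0F , symmetric (spoke 0F))

  reached : ∀ u → Reached u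
  reached u = go (inj₁ near-centre) (connected centre u)
    where
    go : ∀ {x} → Reached x → Star Adj x u → Reached u
    go r ε        = r
    go r (e ◅ es) = go (reached-step r e) es

  Private : Vertex → Vertex → Vertex → Set
  Private w v v′ = Far w × Adj v w × ¬ Adj v′ w

  -- Every case uses a leaf adjacent to both `v` and `v′`. If `v` and `v′` are adjacent, this leaf
  -- is the apex of a bull on `w`, `v`, `v′`, `w′`.
  crossing : ∀ {v v′ w w′} → Near v → Near v′ → Private w v v′ → Private w′ v′ v →
             Adj centre v × Adj centre v′ × ¬ Adj v v′
  crossing {v} {v′} {w} {w′} near near′ (far , vw , v′≁w) (far′ , v′w′ , v≁w′)
    with common-leaf (two-of-three near far vw) (two-of-three near′ far′ v′w′)
  ... | i , vi , v′i with adj? v v′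
  ...   | yes vv′ = ⊥-elim
    (bull-absurd (symmetric vw) vv′ v′w′ (symmetric vi) (symmetric v′i) (≁-sym v′≁w)
      (≁-sym w≁w′) (λ e → far (inj₂ (i , symmetric e))) v≁w′ (λ e → far′ (inj₂ (i , symmetric e))))
    where
    w≁w′ : ¬ Adj w′ w
    w≁w′ = ≁-sym (no-third-step near vw far far′ v≁w′)
  ...   | no v≁v′ with adj? centre v | adj? centre v′
  ...     | yes av | yes av′ = av , av′ , v≁v′
  -- The centre is the apex of a bull whose path runs `w′`, `v′`, `leaf i`, `v`; the next case is
  -- symmetric.
  ...     | no a≁v | yes av′ = ⊥-elim
    (bull-absurd (symmetric v′w′) v′i (symmetric vi) av′ (spoke i) (λ e → far′ (inj₂ (i , symmetric e))) (≁-sym v≁w′)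
       (λ e → far′ (inj₁ (symmetric e))) (≁-sym v≁v′) (≁-sym a≁v))
  ...     | yes av | no a≁v′ = ⊥-elim
    (bull-absurd (symmetric vw) vi (symmetric v′i) av (spoke i) (λ e → far (inj₂ (i , symmetric e))) (≁-sym v′≁w)
       (λ e → far (inj₁ (symmetric e))) v≁v′ (≁-sym a≁v′))
  -- Chair centred at `leaf i` with the leaves `centre` and `v′` and the path through `v` to `w`.
  ...     | no a≁v | no a≁v′ = ⊥-elim
    (chair-absurd (symmetric (spoke i)) (symmetric v′i) (symmetric vi) vw (λ { refl → far′ (inj₁ v′w′) })
      a≁v′ a≁v (≁-sym v≁v′) (λ e → far (inj₁ e)) v′≁w (λ e → far (inj₂ (i , e))))

  Seen : Vertex → Vertex → Vertex → Set
  Seen v₁ v₂ w = Far w × (Adj v₁ w ⊎ Adj v₂ w)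

  seen? : ∀ v₁ v₂ w → Dec (Seen v₁ v₂ w)
  seen? v₁ v₂ w = ¬? (near? w) ×-dec (adj? v₁ w ⊎-dec adj? v₂ w)

  -- Encoded as a `Subset` because strict inclusion is well founded, which makes the exchange
  -- process terminate.
  seen : Vertex → Vertex → Subset order
  seen v₁ v₂ = Vec.tabulate (does ∘ seen? v₁ v₂)

  seen-⊂ : ∀ {v₁ v₂ v₁′ v₂′ w} → (∀ {u} → Seen v₁ v₂ u → Seen v₁′ v₂′ u) →
           Seen v₁′ v₂′ w → ¬ Seen v₁ v₂ w → seen v₁ v₂ ⊂ seen v₁′ v₂′
  seen-⊂ {v₁} {v₂} {v₁′} {v₂′} {w} sub new old =
    ∈-tabulate⁺ (seen? v₁′ v₂′) ∘ sub ∘ ∈-tabulate⁻ (seen? v₁ v₂) ,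
    w , ∈-tabulate⁺ (seen? v₁′ v₂′) new , old ∘ ∈-tabulate⁻ (seen? v₁ v₂)

  -- Such a `w` is a far vertex that would be lost by dropping `v` while keeping `v₁` and `v₂`.
  lost? : ∀ v v₁ v₂ → Dec (∃ λ w → Far w × Adj v w × ¬ Adj v₁ w × ¬ Adj v₂ w)
  lost? v v₁ v₂ = any? λ w → ¬? (near? w) ×-dec (adj? v w ×-dec (¬? (adj? v₁ w) ×-dec ¬? (adj? v₂ w)))

  -- Two leaves suffice, since a near vertex not adjacent to the centre misses at most one of the
  -- three.
  pair-dominating : ∀ {v₁ v₂} → (∀ {w} → Far w → Adj v₁ w ⊎ Adj v₂ w) →
                    Dominating (centre ∷ leaf 0F ∷ leaf 1F ∷ v₁ ∷ v₂ ∷ [])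
  pair-dominating sees u with near? u | adj? centre u
  ... | _ | yes au = here (inj₂ (symmetric au))
  ... | yes near | no a≁u =
    [ (λ e → there (here (inj₂ e))) , (λ e → there (there (here (inj₂ e)))) ]′
      (two-of-three′ near a≁u {0F} {1F} λ ())
  ... | no far | _ =
    [ (λ e → there (there (there (here (inj₂ (symmetric e))))))
    , (λ e → there (there (there (there (here (inj₂ (symmetric e))))))) ]′ (sees far)

  -- If no exchange with v₃ increases what v₁ and v₂ see, then v₁, v₂, v₃ cross pairwise.
  three-crossing : ∀ {v₁ v₂ v₃ w₁ w₂ w₃} → Near v₁ → Near v₂ → Near v₃ →
    Far w₁ × Adj v₁ w₁ × ¬ Adj v₂ w₁ × ¬ Adj v₃ w₁ →
    Far w₂ × Adj v₂ w₂ × ¬ Adj v₁ w₂ × ¬ Adj v₃ w₂ →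
    Far w₃ × Adj v₃ w₃ × ¬ Adj v₁ w₃ × ¬ Adj v₂ w₃ → ⊥
  three-crossing n₁ n₂ n₃ (f₁ , v₁w₁ , v₂≁w₁ , v₃≁w₁) (f₂ , v₂w₂ , v₁≁w₂ , v₃≁w₂) (f₃ , v₃w₃ , v₁≁w₃ , v₂≁w₃)
    with crossing n₁ n₂ (f₁ , v₁w₁ , v₂≁w₁) (f₂ , v₂w₂ , v₁≁w₂)
       | crossing n₁ n₃ (f₁ , v₁w₁ , v₃≁w₁) (f₃ , v₃w₃ , v₁≁w₃)
       | crossing n₂ n₃ (f₂ , v₂w₂ , v₃≁w₂) (f₃ , v₃w₃ , v₂≁w₃)
  ... | av₁ , av₂ , v₁≁v₂ | _ , av₃ , v₁≁v₃ | _ , _ , v₂≁v₃ =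
    chair-absurd av₁ av₂ av₃ v₃w₃ (λ { refl → v₂≁w₁ v₁w₁ }) v₁≁v₂ v₁≁v₃ v₂≁v₃ v₁≁w₃ v₂≁w₃ (λ e → f₃ (inj₁ e))

  -- An unseen far `w₃` has a near neighbour `v₃`. Unless all of `v₁`, `v₂`, `v₃` have private far
  -- neighbours, `v₃` can replace `v₁` or `v₂` without loss, and `w₃` is gained.
  improve : ∀ v₁ v₂ → Near v₁ → Near v₂ → Acc _⊃_ (seen v₁ v₂) → lpt G ≤ 5
  improve v₁ v₂ n₁ n₂ (acc rec) with any? (λ w → ¬? (near? w) ×-dec ¬? (adj? v₁ w ⊎-dec adj? v₂ w))
  ... | no none = dominating⇒lpt≤ (pair-dominating λ {w} far →
          decidable-stable (adj? v₁ w ⊎-dec adj? v₂ w) λ unseen → none (w , far , unseen))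
  ... | yes (w₃ , far₃ , unseen) with reached w₃
  ...   | inj₁ near₃ = contradiction near₃ far₃
  ...   | inj₂ (v₃ , n₃ , v₃w₃) with lost? v₁ v₂ v₃ | lost? v₂ v₁ v₃
  ...     | yes (_ , l₁) | yes (_ , l₂) =
    ⊥-elim (three-crossing n₁ n₂ n₃ l₁ l₂ (far₃ , v₃w₃ , unseen ∘ inj₁ , unseen ∘ inj₂))
  ...     | no ¬l₁ | _ = improve v₃ v₂ n₃ n₂
    (rec (seen-⊂ (λ {u} → keep u) (far₃ , inj₁ v₃w₃) (unseen ∘ proj₂)))
    where
    keep : ∀ u → Seen v₁ v₂ u → Seen v₃ v₂ u
    keep u (far , inj₂ v₂u) = far , inj₂ v₂u
    keep u (far , inj₁ v₁u) = far , decidable-stable (adj? v₃ u ⊎-dec adj? v₂ u)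
      λ new → ¬l₁ (u , far , v₁u , new ∘ inj₂ , new ∘ inj₁)
  ...     | _ | no ¬l₂ = improve v₁ v₃ n₁ n₃
    (rec (seen-⊂ (λ {u} → keep u) (far₃ , inj₂ v₃w₃) (unseen ∘ proj₂)))
    where
    keep : ∀ u → Seen v₁ v₂ u → Seen v₁ v₃ u
    keep u (far , inj₁ v₁u) = far , inj₁ v₁u
    keep u (far , inj₂ v₂u) = far , decidable-stable (adj? v₁ u ⊎-dec adj? v₃ u)
      λ new → ¬l₂ (u , far , v₂u , new ∘ inj₁ , new ∘ inj₂)

  lpt≤5 : lpt G ≤ 5
  lpt≤5 = improve centre centre near-centre near-centre (⊃-wellFounded _)

-- Claw-free graphs and their induced paths.

least : ∀ {P : ℕ → Set} → (∀ i → Dec (P i)) → ∀ {n} → P n → ∃ λ k → k ≤ n × P k × (∀ {j} → j < k → ¬ P j)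
least P? {n} Pn with P? 0
... | yes P0 = 0 , z≤n , P0 , λ ()
least P? {zero}  Pn | no ¬P0 = contradiction Pn ¬P0
least {P} P? {suc n} Pn | no ¬P0 with least (P? ∘ suc) Pn
... | k , k≤n , Pk , below = suc k , s≤s k≤n , Pk , λ { {zero} _ → ¬P0 ; {suc j} (s≤s j<k) → below j<k }

module ClawFree (G : Graph) (connected : Connected G) (free : (bull -Free) G) (noClaw : ¬ Claw G) where
  open Graph G
  open Transversals G

  infix 4 _∥_

  _∥_ : Vertex → Vertex → Set
  u ∥ v = u ≢ v × ¬ Adj u v

  ∥-sym : ∀ {u v} → u ∥ v → v ∥ u
  ∥-sym (u≢v , u≁v) = u≢v ∘ sym , u≁v ∘ symmetric

  bull-absurd : ∀ {w x y z t} → Adj w x → Adj x y → Adj y z → Adj t x → Adj t y →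
                w ∥ y → w ∥ z → w ∥ t → x ∥ z → z ∥ t → ⊥
  bull-absurd wx xy yz tx ty (_ , w≁y) (_ , w≁z) (_ , w≁t) (_ , x≁z) (_ , z≁t) =
    no-bull G free wx xy yz tx ty w≁y w≁z w≁t x≁z z≁t

  claw-absurd : ∀ {a b c d} → Adj a b → Adj a c → Adj a d → b ∥ c → b ∥ d → c ∥ d → ⊥
  claw-absurd {a} {b} {c} {d} ab ac ad b∥c b∥d c∥d = noClaw (record
    { centre = a
    ; leaf   = lookup leaves
    ; spoke  = λ { 0F → ab ; 1F → ac ; 2F → ad }
    ; leaf≢  = λ {i} {j} i≢j → proj₁ (independent i≢j)
    ; leaf≁  = λ {i} {j} → nonadjacent i j
    })
    where
    leaves : Vec Vertex 3
    leaves = b ∷ c ∷ d ∷ []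
    independent : ∀ {i j} → i ≢ j → lookup leaves i ∥ lookup leaves j
    independent {0F} {0F} i≢j = contradiction refl i≢j
    independent {0F} {1F} _   = b∥c
    independent {0F} {2F} _   = b∥d
    independent {1F} {0F} _   = ∥-sym b∥c
    independent {1F} {1F} i≢j = contradiction refl i≢j
    independent {1F} {2F} _   = c∥d
    independent {2F} {0F} _   = ∥-sym b∥d
    independent {2F} {1F} _   = ∥-sym c∥d
    independent {2F} {2F} i≢j = contradiction refl i≢j
    nonadjacent : ∀ i j → ¬ Adj (lookup leaves i) (lookup leaves j)
    nonadjacent i j with i ≟ j
    ... | yes refl = loopless refl
    ... | no i≢j   = proj₂ (independent i≢j)

  -- Only the vertices q 0, …, q m belong to the path.
  record InducedPath (m : ℕ) : Set where
    field
      q     : ℕ → Vertex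
      edge  : ∀ {i} → i < m → Adj (q i) (q (suc i))
      apart : ∀ {i j} → suc i < j → j ≤ m → q i ∥ q j
  open InducedPath

  cons : ∀ {m} (P : InducedPath m) u →
         Adj u (q P 0) → (∀ {i} → 0 < i → i ≤ m → u ∥ q P i) → InducedPath (suc m)
  cons P u u~ u∥ = record
    { q     = λ { zero → u ; (suc i) → q P i }
    ; edge  = λ { {zero} _ → u~ ; {suc i} (s≤s i<m) → edge P i<m }
    ; apart = λ { {zero} {suc j} (s≤s 0<j) (s≤s j≤m) → u∥ 0<j j≤m
              ; {suc i} {suc j} (s≤s i<j) (s≤s j≤m) → apart P i<j j≤m
              }
    }

  tail : ∀ {m} → InducedPath (suc m) → InducedPath m
  tail P = record
    { q     = q P ∘ suc
    ; edge  = λ i<m → edge P (s≤s i<m)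
    ; apart = λ i<j j≤m → apart P (s≤s i<j) (s≤s j≤m)
    }

  reverse : ∀ {m} → InducedPath m → InducedPath m
  reverse {m} P = record
    { q     = λ i → q P (m ∸ i)
    ; edge  = λ {i} i<m → symmetric (subst (λ k → Adj (q P (m ∸ suc i)) (q P k)) (sym (ℕ.+-∸-assoc 1 i<m))
                (edge P (subst (_≤ m) (ℕ.+-∸-assoc 1 i<m) (ℕ.m∸n≤m m i))))
    ; apart = λ {i} {j} i<j j≤m → ∥-sym (apart P
                (ℕ.<-≤-trans (s≤s (ℕ.∸-monoʳ-< i<j j≤m))
                  (≤-reflexive (sym (ℕ.+-∸-assoc 1 (ℕ.<⇒≤ (≤-trans i<j j≤m))))))
                (ℕ.m∸n≤m m i))
    }

  length<order : ∀ {m} → InducedPath m → m < order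
  length<order {m} P = injective⇒≤ {f = q P ∘ toℕ} inj
    where
    distinct : ∀ {i j} → i < j → j ≤ m → q P i ≢ q P j
    distinct i<j j≤m with ℕ.m≤n⇒m<n∨m≡n i<j
    ... | inj₁ i+1<j = proj₁ (apart P i+1<j j≤m)
    ... | inj₂ refl  = λ e → loopless e (edge P j≤m)
    inj : ∀ {i j : Fin (suc m)} → q P (toℕ i) ≡ q P (toℕ j) → i ≡ j
    inj {i} {j} e with ℕ.<-cmp (toℕ i) (toℕ j)
    ... | tri< i<j _ _ = contradiction e (distinct i<j (s≤s⁻¹ (toℕ<n j)))
    ... | tri≈ _ i≡j _ = toℕ-injective i≡j
    ... | tri> _ _ j<i = contradiction (sym e) (distinct j<i (s≤s⁻¹ (toℕ<n i)))

  snoc : ∀ {m} (P : InducedPath m) u → Adj u (q P m) → (∀ {i} → i < m → u ∥ q P i) → InducedPath (suc m)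
  snoc {m} P u u~ u∥ = cons (reverse P) u u~ λ 0<i i≤m → u∥ (ℕ.∸-monoʳ-< 0<i i≤m)

  -- The new path is `w`, `u`, `q 1`, ..., `q m`: one vertex is dropped and two are added.
  replace-head : ∀ {m} → 0 < m → (P : InducedPath m) → ∀ u w →
                 Adj u (q P 1) → (∀ {i} → 1 < i → i ≤ m → u ∥ q P i) →
                 Adj w u → (∀ {i} → i ≤ m → w ∥ q P i) → InducedPath (suc m)
  replace-head (s≤s _) P u w u~ u∥ wu w∥ =
    cons (cons (tail P) u u~ λ { 0<i i≤m → u∥ (s≤s 0<i) (s≤s i≤m) }) w wu
      λ { {suc i} _ (s≤s i≤m) → w∥ (s≤s i≤m) }

  module Outside {m} (P : InducedPath m) {u : Vertex} (u∉P : ∀ {i} → i ≤ m → u ≢ q P i) where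
    A : ℕ → Set
    A i = Adj u (q P i)

    a? : ∀ i → Dec (A i)
    a? i = adj? u (q P i)

    ¬A⇒∥ : ∀ {i} → i ≤ m → ¬ A i → u ∥ q P i
    ¬A⇒∥ i≤m ¬a = u∉P i≤m , ¬a

    -- Otherwise `q (1 + i)` is the centre of a claw with the leaves `u`, `q i` and `q (2 + i)`.
    interior : ∀ {i} → 2 + i ≤ m → A (1 + i) → A i ⊎ A (2 + i)
    interior {i} i≤m a with a? i | a? (2 + i)
    ... | yes a₀ | _      = inj₁ a₀
    ... | _      | yes a₂ = inj₂ a₂
    ... | no ¬a₀ | no ¬a₂ = ⊥-elim (claw-absurd (symmetric a) (symmetric (edge P (ℕ.<⇒≤ i≤m))) (edge P i≤m)
      (¬A⇒∥ (ℕ.<⇒≤ (ℕ.<⇒≤ i≤m)) ¬a₀) (¬A⇒∥ i≤m ¬a₂) (apart P (n<1+n _) i≤m))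

    -- Otherwise `u` is the apex of a bull on the path from `q i` to `q (3 + i)`.
    next-two : ∀ {i} → 3 + i ≤ m → ¬ A i → A (1 + i) → A (2 + i) → A (3 + i)
    next-two {i} 3+i≤m ¬a₀ a₁ a₂ with a? (3 + i)
    ... | yes a₃ = a₃
    ... | no ¬a₃ = ⊥-elim (bull-absurd (edge P (ℕ.<⇒≤ (ℕ.<⇒≤ 3+i≤m))) (edge P (ℕ.<⇒≤ 3+i≤m)) (edge P 3+i≤m) a₁ a₂
      (apart P ≤-refl (ℕ.<⇒≤ 3+i≤m)) (apart P (n≤1+n _) 3+i≤m) (∥-sym (¬A⇒∥ (ℕ.<⇒≤ (ℕ.<⇒≤ (ℕ.<⇒≤ 3+i≤m))) ¬a₀))
      (apart P ≤-refl 3+i≤m) (∥-sym (¬A⇒∥ 3+i≤m ¬a₃)))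

    triple : ∀ {i j k} → A i → A j → A k → suc i < j → suc j < k → k ≤ m → ⊥
    triple ai aj ak i<j j<k k≤m = claw-absurd ai aj ak
      (apart P i<j (≤-trans (n≤1+n _) (≤-trans (ℕ.<⇒≤ j<k) k≤m)))
      (apart P (ℕ.<-trans i<j (ℕ.<⇒≤ j<k)) k≤m) (apart P j<k k≤m)

  -- Domination by a longest induced path.

  module Longest {m} (P : InducedPath m) (longest : ¬ InducedPath (suc m)) where
    on : ℕ → Vertex
    on = q P

    Close : Vertex → Set
    Close u = ∃ λ i → i < suc m × (u ≡ on i ⊎ Adj u (on i))

    close? : ∀ u → Dec (Close u)
    close? u = anyUpTo? (λ i → (u ≟ on i) ⊎-dec adj? u (on i)) (suc m)

    no-tail : ∀ {u} → Adj u (on m) → (∀ {i} → i < m → u ∥ on i) → ⊥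
    no-tail u~ u∥ = longest (snoc P _ u~ u∥)

    no-head : ∀ {u} → Adj u (on 0) → (∀ {i} → 0 < i → i ≤ m → u ∥ on i) → ⊥
    no-head u~ u∥ = longest (cons P _ u~ u∥)

    -- As `w` is far from the path, two non-consecutive neighbours of `u` on it would give a claw at
    -- `u`. So `u` has one neighbour there or two consecutive ones. Inside the path this yields a
    -- claw or a bull; at an end the path can be lengthened by `u`, or by `u` and `w` in place of
    -- the end vertex.
    no-second-neighbour : ∀ {u w} → Adj u w → ¬ Close w → (∀ {i} → i ≤ m → u ≢ on i) → ∀ {i} → i ≤ m → ¬ Adj u (on i)
    no-second-neighbour {u} {w} uw far u∉P {i} i≤m ui with least (λ i → adj? u (on i)) ui
    ... | k , k≤i , ak , below = go k (≤-trans k≤i i≤m) ak below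
      where
      open Outside P u∉P
      w∥ : ∀ {i} → i ≤ m → w ∥ on i
      w∥ i≤m = (λ e → far (_ , s≤s i≤m , inj₁ e)) , (λ e → far (_ , s≤s i≤m , inj₂ e))
      clique : ∀ {i j} → A i → A j → suc i < j → j ≤ m → ⊥
      clique ai aj i<j j≤m = claw-absurd uw ai aj (w∥ (≤-trans (ℕ.<⇒≤ (ℕ.<⇒≤ i<j)) j≤m)) (w∥ j≤m) (apart P i<j j≤m)
      go : ∀ k → k ≤ m → A k → (∀ {j} → j < k → ¬ A j) → ⊥
      go zero _ a₀ _ with a? 1 | ℕ.m≤n⇒m<n∨m≡n (z≤n {m})
      ... | _ | inj₂ refl = no-head a₀ λ 0<i i≤0 → contradiction (≤-trans 0<i i≤0) λ ()
      ... | no ¬a₁ | _ = no-head a₀ λ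
        { {1} _ 1≤m → ¬A⇒∥ 1≤m ¬a₁ ; {suc (suc i)} _ i≤m → ¬A⇒∥ i≤m λ a → clique a₀ a (s≤s (s≤s z≤n)) i≤m }
      ... | yes a₁ | inj₁ 0<m = longest (replace-head 0<m P _ _ a₁
        (λ 1<i i≤m → ¬A⇒∥ i≤m λ a → clique a₀ a 1<i i≤m) (symmetric uw) w∥)
      go (suc k) k≤m a below with ℕ.m≤n⇒m<n∨m≡n k≤m
      ... | inj₂ refl = no-tail a λ i<m → ¬A⇒∥ (ℕ.<⇒≤ i<m) (below i<m)
      ... | inj₁ k<m with interior k<m a
      ...   | inj₁ a₀ = below ≤-refl a₀
      ...   | inj₂ a₂ with ℕ.m≤n⇒m<n∨m≡n k<m
      ...     | inj₁ 3+k≤m = clique a (next-two 3+k≤m (below ≤-refl) a a₂) ≤-refl 3+k≤m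
      -- The neighbours are the last two vertices; on the reversed path they are the first two.
      ...     | inj₂ refl = longest (replace-head (s≤s z≤n) (reverse P) _ _ a
        (λ {i} 1<i i≤m → ¬A⇒∥ (ℕ.m∸n≤m m i) (below (ℕ.∸-monoʳ-< 1<i i≤m)))
        (symmetric uw) (λ {i} _ → w∥ (ℕ.m∸n≤m m i)))

    all-close : ∀ u → Close u
    all-close u = go (0 , s≤s z≤n , inj₁ refl) (connected (on 0) u)
      where
      step : ∀ {u w} → Close u → Adj u w → Close w
      step (i , i≤m , inj₁ refl) uw = i , i≤m , inj₂ (symmetric uw)
      step {u} {w} (i , s≤s i≤m , inj₂ ui) uw with close? w
      ... | yes close = close
      ... | no far = contradiction ui
        (no-second-neighbour uw far (λ { j≤m refl → far (_ , s≤s j≤m , inj₂ (symmetric uw)) }) i≤m)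
      go : ∀ {x} → Close x → Star Adj x u → Close u
      go c ε        = c
      go c (e ◅ es) = go (step c e) es

    path-dominating : Dominating (List.applyUpTo on (suc m))
    path-dominating u with all-close u
    ... | i , i<m , close = Any.applyUpTo⁺ on close i<m

    short⇒lpt≤ : m ≤ 4 → lpt G ≤ 5
    short⇒lpt≤ m≤4 = ≤-trans (dominating⇒lpt≤ path-dominating)
      (subst (_≤ 5) (sym (List.length-applyUpTo on (suc m))) (s≤s m≤4))

    -- Classes of vertices along an induced path with at least five edges.

    module Long (5≤m : 5 ≤ m) where

      -- The vertex `u` meets the path as `on c` does, up to being `on c` or a neighbour of it. The
      -- premises of `below` and `above` make them vacuous at the ends of the path.
      record Inner (u : Vertex) (c : ℕ) : Set where
        field
          same  : u ≡ on c ⊎ Adj u (on c)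
          below : ∀ {i} → suc i ≡ c → Adj u (on i)
          above : suc c ≤ m → Adj u (on (suc c))
          far<  : ∀ {i} → suc i < c → u ∥ on i
          far>  : ∀ {i} → suc c < i → i ≤ m → u ∥ on i

      -- The vertices closing the path to a cycle come last, with number `suc m`: theirs is the only
      -- class without a path vertex, so it may be empty.
      data Class (u : Vertex) : ℕ → Set where
        inner : ∀ {c} → c ≤ m → Inner u c → Class u c
        outer : Adj u (on 0) → Adj u (on m) → (∀ {i} → 0 < i → i < m → u ∥ on i) →
                (∀ {i} → i ≤ m → u ≢ on i) → Class u (suc m)

      on-inner : ∀ {i} → i ≤ m → Inner (on i) i
      on-inner i≤m = record
        { same  = inj₁ refl
        ; below = λ { refl → symmetric (edge P i≤m) }
        ; above = edge P
        ; far<  = λ j<i → ∥-sym (apart P j<i i≤m)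
        ; far>  = apart P
        }

      -- Any other class would make `on i` distinct from itself or adjacent to itself. Hence the
      -- classes up to `m` are nonempty, as the layering demands.
      on-class-unique : ∀ {i c} → i ≤ m → Class (on i) c → c ≡ i
      on-class-unique i≤m (outer _ _ _ u∉P) = contradiction refl (u∉P i≤m)
      on-class-unique {i} {c} i≤m (inner c≤m l) with ℕ.<-cmp c i
      ... | tri≈ _ c≡i _ = c≡i
      ... | tri< c<i _ _ with ℕ.m≤n⇒m<n∨m≡n c<i
      ...   | inj₁ c+1<i = contradiction refl (proj₁ (Inner.far> l c+1<i i≤m))
      ...   | inj₂ refl  = contradiction (Inner.above l i≤m) (loopless refl)
      on-class-unique {i} {c} i≤m (inner c≤m l) | tri> _ _ i<c with ℕ.m≤n⇒m<n∨m≡n i<c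
      ...   | inj₁ i+1<c = contradiction refl (proj₁ (Inner.far< l i+1<c))
      ...   | inj₂ refl  = contradiction (Inner.below l refl) (loopless refl)

      module _ {u : Vertex} (u∉P : ∀ {i} → i ≤ m → u ≢ on i) where
        open Outside P u∉P

        at : ∀ k {k≤5 : True (k ℕ.≤? 5)} → k ≤ m
        at k {k≤5} = ≤-trans (toWitness k≤5) 5≤m

        -- The first neighbour is `on (suc i)`. It is not the last path vertex, so `interior` adds
        -- `on (2 + i)`, and `u` behaves like the latter.
        classify-late : ∀ {i} → suc i ≤ m → A (suc i) → (∀ {j} → j < suc i → ¬ A j) → ∃ (Class u)
        classify-late {i} 1+i≤m a₁ before with ℕ.m≤n⇒m<n∨m≡n 1+i≤m
        ... | inj₂ refl = ⊥-elim (no-tail a₁ λ j<m → ¬A⇒∥ (ℕ.<⇒≤ j<m) (before j<m))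
        ... | inj₁ 2+i≤m with interior 2+i≤m a₁
        ...   | inj₁ a₀ = contradiction a₀ (before ≤-refl)
        ...   | inj₂ a₂ = 2 + i , inner 2+i≤m record
          { same  = inj₂ a₂
          ; below = λ { refl → a₁ }
          ; above = λ 3+i≤m → next-two 3+i≤m (before ≤-refl) a₁ a₂
          ; far<  = λ { (s≤s j<1+i) → ¬A⇒∥ (≤-trans (ℕ.<⇒≤ j<1+i) 1+i≤m) (before j<1+i) }
          ; far>  = λ 3+i<j j≤m → ¬A⇒∥ j≤m λ aj → no-further 3+i<j j≤m aj
          }
          where
          no-further : ∀ {j} → 3 + i < j → j ≤ m → ¬ A j
          no-further 3+i<j j≤m aj with next-two (≤-trans (ℕ.<⇒≤ 3+i<j) j≤m) (before ≤-refl) a₁ a₂ | ℕ.m≤n⇒m<n∨m≡n 3+i<j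
          ... | a₃ | inj₁ 4+i<j = triple a₁ a₃ aj (n<1+n _) 4+i<j j≤m
          -- Bull on `on i`, `on (1 + i)`, `u`, `on (4 + i)` with apex `on (2 + i)`.
          ... | a₃ | inj₂ refl  = bull-absurd (edge P (≤-trans (m≤n+m _ 3) j≤m)) (symmetric a₁) aj
            (symmetric (edge P 2+i≤m)) (symmetric a₂)
            (∥-sym (¬A⇒∥ (≤-trans (n≤1+n _) 1+i≤m) (before ≤-refl)))
            (apart P (m≤n+m _ 2) j≤m) (apart P ≤-refl 2+i≤m)
            (apart P (n≤1+n _) j≤m) (∥-sym (apart P ≤-refl j≤m))

        classify-01 : A 0 → A 1 → ∃ (Class u)
        classify-01 a₀ a₁ with a? 2
        ... | yes a₂ = 1 , inner (at 1) record
          { same  = inj₂ a₁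
          ; below = λ { refl → a₀ }
          ; above = λ _ → a₂
          ; far<  = λ { (s≤s ()) }
          ; far>  = λ 2<j j≤m → ¬A⇒∥ j≤m (no-further 2<j j≤m)
          }
          where
          no-further : ∀ {j} → 2 < j → j ≤ m → ¬ A j
          no-further 2<j j≤m aj with ℕ.m≤n⇒m<n∨m≡n 2<j
          ... | inj₁ 3<j  = triple a₀ a₂ aj ≤-refl 3<j j≤m
          -- Bull on `on 4`, `on 3`, `u`, `on 0` with apex `on 2`.
          ... | inj₂ refl = bull-absurd (symmetric (edge P (at 4))) (symmetric aj) a₀ (edge P (at 3)) (symmetric a₂)
            (∥-sym (¬A⇒∥ (at 4) λ a₄ → triple a₀ a₂ a₄ ≤-refl ≤-refl (at 4)))
            (∥-sym (apart P (m≤n+m _ 2) (at 4))) (∥-sym (apart P ≤-refl (at 4)))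
            (∥-sym (apart P (n≤1+n _) (at 3))) (apart P ≤-refl (at 2))
        ... | no ¬a₂ = 0 , inner z≤n record
          { same  = inj₂ a₀
          ; below = λ ()
          ; above = λ _ → a₁
          ; far<  = λ ()
          ; far>  = λ 1<j j≤m → ¬A⇒∥ j≤m (no-further 1<j j≤m)
          }
          where
          none-from-4 : ∀ {j} → 3 < j → j ≤ m → ¬ A j
          -- Bull on `on j`, `u`, `on 1`, `on 2` with apex `on 0`.
          none-from-4 3<j j≤m aj = bull-absurd (symmetric aj) a₁ (edge P (at 2)) (symmetric a₀) (edge P (at 1))
            (∥-sym (apart P (ℕ.<⇒≤ 3<j) j≤m)) (∥-sym (apart P 3<j j≤m)) (∥-sym (apart P (≤-trans (n≤1+n _) (ℕ.<⇒≤ 3<j)) j≤m))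
            (¬A⇒∥ (at 2) ¬a₂) (∥-sym (apart P ≤-refl (at 2)))
          no-further : ∀ {j} → 1 < j → j ≤ m → ¬ A j
          no-further {1} (s≤s ())
          no-further {2} _ _ = ¬a₂
          no-further {3} _ _ a₃ = [ ¬a₂ , none-from-4 ≤-refl (at 4) ]′ (interior (at 4) a₃)
          no-further {suc (suc (suc (suc _)))} _ j≤m = none-from-4 (s≤s (s≤s (s≤s (s≤s z≤n)))) j≤m

        -- By maximality `u` has a neighbour beyond `on 0`. The first such, `on (2 + k)`, must be
        -- the last path vertex, so `u` closes the path to a cycle.
        classify-0 : A 0 → ¬ A 1 → ∃ (Class u)
        classify-0 a₀ ¬a₁ with anyUpTo? (λ j → a? (suc j)) m
        ... | no none = ⊥-elim (no-head a₀ λ { {suc j} _ j<m → ¬A⇒∥ j<m λ a → none (j , j<m , a) })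
        ... | yes (j , j<m , aj) with least (λ j → a? (suc j)) aj
        ...   | zero  , _   , a₁ , _      = contradiction a₁ ¬a₁
        ...   | suc k , k<j , a  , before = suc m , outer a₀ (subst A (sym m≡2+k) a)
          (λ { {suc i} _ i<m → ¬A⇒∥ (ℕ.<⇒≤ i<m) (before (s≤s⁻¹ (subst (suc i <_) m≡2+k i<m))) }) u∉P
          where
          bound : 2 + k ≤ m
          bound = ≤-trans (s≤s k<j) j<m

          ¬3+k≤m : ¬ 3 + k ≤ m
          ¬3+k≤m 3+k≤m with interior 3+k≤m a
          ... | inj₁ a₁₊ₖ = before ≤-refl a₁₊ₖ
          ... | inj₂ a₃₊ₖ with ℕ.m≤n⇒m<n∨m≡n 3+k≤m
          -- Here `m` is `3 + k`, so `5 ≤ m` gives `2 ≤ k` and keeps `on 0` apart from `on (1 + k)`,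
          -- the two ends of the bull's path.
          ...   | inj₂ refl = bull-absurd (symmetric a₀) a (symmetric (edge P bound)) (symmetric a₃₊ₖ) (symmetric (edge P 3+k≤m))
            (apart P (s≤s (s≤s z≤n)) bound) (apart P (ℕ.<⇒≤ (s≤s⁻¹ (s≤s⁻¹ 5≤m))) (ℕ.<⇒≤ bound))
            (apart P (s≤s (s≤s z≤n)) 3+k≤m)
            (¬A⇒∥ (ℕ.<⇒≤ bound) (before ≤-refl)) (apart P ≤-refl 3+k≤m)
          ...   | inj₁ 4+k≤m with a? (4 + k)
          ...     | yes a₄₊ₖ = triple a₀ a a₄₊ₖ (s≤s (s≤s z≤n)) ≤-refl 4+k≤m
          ...     | no ¬a₄₊ₖ = bull-absurd (symmetric a₀) a₃₊ₖ (edge P 4+k≤m) (symmetric a) (edge P 3+k≤m)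
            (apart P (s≤s (s≤s z≤n)) 3+k≤m) (apart P (s≤s (s≤s z≤n)) 4+k≤m) (apart P (s≤s (s≤s z≤n)) bound)
            (¬A⇒∥ 4+k≤m ¬a₄₊ₖ) (∥-sym (apart P ≤-refl 4+k≤m))

          m≡2+k : m ≡ 2 + k
          m≡2+k with ℕ.m≤n⇒m<n∨m≡n bound
          ... | inj₁ 3+k≤m = contradiction 3+k≤m ¬3+k≤m
          ... | inj₂ 2+k≡m = sym 2+k≡m

      classify : ∀ u → ∃ (Class u)
      classify u with anyUpTo? (λ i → u ≟ on i) (suc m) | all-close u
      ... | yes (i , s≤s i≤m , refl) | _ = i , inner i≤m (on-inner i≤m)
      ... | no u∉P | i , i≤m , inj₁ u≡ = contradiction (i , i≤m , u≡) u∉P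
      ... | no u∉P | i , s≤s i≤m , inj₂ ui with least (λ i → adj? u (on i)) ui
      ...   | suc k , k≤i , a , before = classify-late (λ i≤m u≡ → u∉P (_ , s≤s i≤m , u≡)) (≤-trans k≤i i≤m) a before
      ...   | zero , _ , a₀ , _ with adj? u (on 1)
      ...     | yes a₁ = classify-01 (λ i≤m u≡ → u∉P (_ , s≤s i≤m , u≡)) a₀ a₁
      ...     | no ¬a₁ = classify-0 (λ i≤m u≡ → u∉P (_ , s≤s i≤m , u≡)) a₀ ¬a₁

      open Inner

      -- Non-adjacent `u` and `v` would be leaves of a claw centred at `on (1 + c)` with third leaf
      -- `on (2 + c)`, or, near the end of the path, of its mirror image. For the outer class the
      -- centre is `on 0`.
      same-class : ∀ {u v c} → u ≢ v → Class u c → Class v c → Adj u v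
      same-class {u} {v} {c} u≢v lu lv = decidable-stable (adj? u v) λ u≁v → absurd (u≢v , u≁v) lu lv
        where
        absurd : ∀ {c} → u ∥ v → Class u c → Class v c → ⊥
        absurd u∥v (inner c≤m _) (outer _ _ _ _) = 1+n≰n c≤m
        absurd u∥v (outer _ _ _ _) (inner c≤m _) = 1+n≰n c≤m
        absurd u∥v (outer u₀ _ u∥ _) (outer v₀ _ v∥ _) =
          claw-absurd (symmetric u₀) (symmetric v₀) (edge P (≤-trans (s≤s z≤n) 5≤m)) u∥v
            (u∥ (s≤s z≤n) (≤-trans (s≤s (s≤s z≤n)) 5≤m)) (v∥ (s≤s z≤n) (≤-trans (s≤s (s≤s z≤n)) 5≤m))
        absurd {c} u∥v (inner c≤m iu) (inner _ iv) with 2 + c ℕ.≤? m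
        ... | yes 2+c≤m = claw-absurd (symmetric (above iu (ℕ.<⇒≤ 2+c≤m))) (symmetric (above iv (ℕ.<⇒≤ 2+c≤m))) (edge P 2+c≤m)
          u∥v (far> iu ≤-refl 2+c≤m) (far> iv ≤-refl 2+c≤m)
        absurd {zero}         _   _              _ | no 2≰m = 2≰m (≤-trans (s≤s (s≤s z≤n)) 5≤m)
        absurd {suc zero}     _   _              _ | no 3≰m = 3≰m (≤-trans (s≤s (s≤s (s≤s z≤n))) 5≤m)
        absurd {suc (suc c)} u∥v (inner c≤m iu) (inner _ iv) | no _ =
          claw-absurd (symmetric (below iu refl)) (symmetric (below iv refl)) (symmetric (edge P (ℕ.<⇒≤ c≤m)))
            u∥v (far< iu ≤-refl) (far< iv ≤-refl)

      -- Otherwise `u` is the apex of a bull on `v`, `on (2 + k)`, `on (1 + k)`, `on k`. This serves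
      -- the end of the path, where there is no room upwards.
      downward : ∀ {u v k} → 2 + k ≤ m → Inner u (2 + k) → Adj v (on (2 + k)) → v ∥ on (1 + k) → v ∥ on k → Adj u v
      downward {u} {v} {k} c≤m iu vc v∥₁ v∥₀ with same iu
      ... | inj₁ refl = symmetric vc
      ... | inj₂ uc = decidable-stable (adj? u v) λ u≁v →
        bull-absurd vc (symmetric (edge P c≤m)) (symmetric (edge P (ℕ.<⇒≤ c≤m)))
        uc (below iu refl) v∥₁ v∥₀ ((λ { refl → proj₂ v∥₁ (below iu refl) }) , u≁v ∘ symmetric)
        (∥-sym (apart P ≤-refl c≤m)) (∥-sym (far< iu ≤-refl))

      -- If `3 + c ≤ m`, a missing edge makes `v` the apex of a bull on `u`, `on (1 + c)`,
      -- `on (2 + c)`, `on (3 + c)`. Otherwise `5 ≤ m` forces `2 ≤ c`, and `downward` applies.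
      next-class : ∀ {u v c} → Class u c → Class v (suc c) → Adj u v
      next-class (outer _ _ _ _) (inner c≤m _) = contradiction (ℕ.<⇒≤ c≤m) 1+n≰n
      next-class (inner c≤m iu) (outer _ vm v∥ _) with ℕ.m≤n⇒∃[o]m+o≡n (≤-trans (s≤s (s≤s (z≤n {3}))) 5≤m)
      ... | k , refl = downward c≤m iu vm (v∥ (s≤s z≤n) ≤-refl) (v∥ (s≤s⁻¹ (s≤s⁻¹ (ℕ.<⇒≤ (ℕ.<⇒≤ 5≤m)))) (n≤1+n _))
      next-class {u} {v} {c} (inner c≤m iu) (inner c<m iv) with 3 + c ℕ.≤? m
      next-class {u} {v} {c} (inner c≤m iu) (inner c<m iv) | yes 3+c≤m with same iv
      ... | inj₁ refl = above iu c<m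
      ... | inj₂ v₁   = decidable-stable (adj? u v) λ u≁v →
        bull-absurd (above iu c<m) (edge P (ℕ.<⇒≤ 3+c≤m)) (edge P 3+c≤m) v₁ (above iv (ℕ.<⇒≤ 3+c≤m))
          (far> iu ≤-refl (ℕ.<⇒≤ 3+c≤m)) (far> iu (n≤1+n _) 3+c≤m)
          ((λ { refl → proj₂ (far> iu ≤-refl (ℕ.<⇒≤ 3+c≤m)) (above iv (ℕ.<⇒≤ 3+c≤m)) }) , u≁v)
          (apart P ≤-refl 3+c≤m) (∥-sym (far> iv ≤-refl 3+c≤m))
      next-class {c = 0} _ _ | no 3≰m = contradiction (≤-trans (m≤n+m 3 2) 5≤m) 3≰m
      next-class {c = 1} _ _ | no 4≰m = contradiction (≤-trans (m≤n+m 4 1) 5≤m) 4≰m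
      next-class {c = suc (suc k)} (inner c≤m iu) (inner c<m iv) | no _ =
        downward c≤m iu (below iv refl) (far< iv ≤-refl) (far< iv (n≤1+n _))

      lpt≤1 : lpt G ≤ 1
      lpt≤1 = Layered.lpt≤1 (proj₁ ∘ classify) level≤
        (λ {u} {v} u≢v e → same-class u≢v (subst (Class u) e (proj₂ (classify u))) (proj₂ (classify v)))
        (λ {u} {v} e → next-class (proj₂ (classify u)) (subst (Class v) (sym e) (proj₂ (classify v))))
        (λ { {c} (s≤s c≤m) → on c , on-class-unique c≤m (proj₂ (classify (on c))) })
        (on 0)
        where
        level≤ : ∀ u → proj₁ (classify u) ≤ suc m
        level≤ u with classify u
        ... | _ , inner c≤m _     = m≤n⇒m≤1+n c≤m
        ... | _ , outer _ _ _ _   = ≤-refl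

    lpt≤5 : lpt G ≤ 5
    lpt≤5 with m ℕ.≤? 4
    ... | yes m≤4 = short⇒lpt≤ m≤4
    ... | no m≰4  = ≤-trans (Long.lpt≤1 (ℕ.≰⇒> m≰4)) (s≤s z≤n)

  -- Since _≤_ is decidable, we may assume that a path has no induced extension.
  extend : ∀ fuel {m} → InducedPath m → order ≤ fuel + m → lpt G ≤ 5
  extend zero       P order≤ = contradiction (≤-trans (length<order P) order≤) 1+n≰n
  extend (suc fuel) {m} P order≤ = decidable-stable (lpt G ℕ.≤? 5) λ ≰5 → ≰5 (Longest.lpt≤5 P λ P′ →
    ≰5 (extend fuel P′ (≤-trans order≤ (≤-reflexive (sym (ℕ.+-suc fuel m))))))

  single : Vertex → InducedPath 0
  single v = record
    { q     = λ _ → v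
    ; edge  = λ ()
    ; apart = λ { {j = zero} () _ ; {j = suc _} _ () }
    }

  lpt≤5 : lpt G ≤ 5
  -- A search for a vertex with a trivial property decides whether the graph is empty.
  lpt≤5 with any? {n = order} (λ _ → yes tt)
  ... | yes (v , _) = extend order (single v) (m≤m+n order 0)
  ... | no none     = ≤-trans (dominating⇒lpt≤ {[]} λ u → contradiction (u , tt) none) z≤n

theorem3p9 : (G : Graph) → Connected G → Bull-Chair-Free G → lpt G ≤ 5
theorem3p9 G connected free@(bull-free , _) = decidable-stable (lpt G ℕ.≤? 5) λ ≰5 →
  -- The case distinction on the existence of a claw takes place under a double negation, which the
  -- decidable conclusion removes.
  ≰5 (ClawFree.lpt≤5 G connected bull-free λ claw → ≰5 (ClawCase.lpt≤5 G connected free claw))
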